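{- For every positive integer $n$, the number $\widetilde{V}(n)$ of valved minimal bridges from $(0,0)$ to $(3n,2n)$ satisfies $$\widetilde{V}(n)=6\,\widetilde{D}(n)-\frac{4}{5n-1}\binom{5n-1}{2n},$$ where $\widetilde{D}(n)$ is the number of minimal Duchon paths from $(0,0)$ to $(3n,2n)$.
   Context: All paths are lattice paths in $\mathbb{Z}^2$ composed only of unit steps to the right $(1,0)$ and up $(0,1)$. The diagonal is the line $y=2x/3$. A bridge is a path from $(0,0)$ to $(3n,2n)$. A minimal bridge is a nontrivial bridge that contains no lattice points on the diagonal other than its two endpoints. A minimal Duchon path is a minimal excursion with respect to $y=2x/3$, i.e. a bridge all of whose lattice points other than the two endpoints lie strictly above the diagonal. A valved path is a path that does not cross from on or above the diagonal to below the diagonal, except possibly with its first step; equivalently, no right step other than possibly the first step of the path starts at a point on or above the diagonal and ends at a point strictly below the diagonal. A valved minimal bridge is a minimal bridge that is also a valved path. -}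

module Defs where

open import Data.Nat.Base using (ℕ; zero; suc; _+_; _*_; _∸_; _≤_; _<_; NonZero)
open import Data.Nat.Properties as ℕ using (+-suc)
open import Data.List.Base using (List; []; _∷_; drop; filter; length; cartesianProductWith)
open import Data.List.Membership.Propositional using (_∈_)
open import Data.List.Membership.Propositional.Properties
  using (∈-cartesianProductWith⁺; ∈-filter⁺; ∈-filter⁻)
import Data.List.Properties as List
open import Data.List.Relation.Unary.All using (All; []; _∷_; all?)
open import Data.List.Relation.Unary.AllPairs using ([]; _∷_)
open import Data.List.Relation.Unary.Any using (here; there)
open import Data.List.Relation.Unary.Unique.Propositional using (Unique)
import Data.List.Relation.Unary.Unique.Propositional.Properties as Unique
open import Data.Product.Base using (_×_; _,_; proj₁; proj₂)
import Data.Product.Properties as Product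
open import Data.Sum.Base using (_⊎_)
open import Level using (0ℓ)
open import Function.Bundles using (_⇔_; mk⇔)
open import Relation.Binary.Definitions using (DecidableEquality)
open import Relation.Binary.PropositionalEquality
open import Relation.Nullary using (¬_; yes; no; ¬?; _×-dec_; _⊎-dec_; _→-dec_)
open import Relation.Unary using (Pred; Decidable)

-- Every path considered starts at the origin and uses only right and up steps,
-- so natural-number coordinates suffice.
Point : Set
Point = ℕ × ℕ

data Step : Set where
  right up : Step

Path : Set
Path = List Step

origin : Point
origin = 0 , 0

_▷_ : Point → Step → Point
(x , y) ▷ right = suc x , y
(x , y) ▷ up    = x , suc y

endpointFrom : Point → Path → Point
endpointFrom p []      = p
endpointFrom p (s ∷ w) = endpointFrom (p ▷ s) w

latticePointsFrom : Point → Path → List Point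
latticePointsFrom p []      = p ∷ []
latticePointsFrom p (s ∷ w) = p ∷ latticePointsFrom (p ▷ s) w

-- Each step is paired with the point at which it starts.
locatedStepsFrom : Point → Path → List (Point × Step)
locatedStepsFrom p []      = []
locatedStepsFrom p (s ∷ w) = (p , s) ∷ locatedStepsFrom (p ▷ s) w

endpoint : Path → Point
endpoint = endpointFrom origin

latticePoints : Path → List Point
latticePoints = latticePointsFrom origin

locatedSteps : Path → List (Point × Step)
locatedSteps = locatedStepsFrom origin

-- Position relative to the line y = 2x/3, with denominators cleared.
OnDiagonal StrictlyAbove OnOrAbove StrictlyBelow : Pred Point 0ℓ
OnDiagonal    (x , y) = 3 * y ≡ 2 * x
StrictlyAbove (x , y) = 2 * x < 3 * y
OnOrAbove     (x , y) = 2 * x ≤ 3 * y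
StrictlyBelow (x , y) = 3 * y < 2 * x

corner : ℕ → Point
corner n = 3 * n , 2 * n

IsBridge : ℕ → Pred Path 0ℓ
IsBridge n w = endpoint w ≡ corner n

IsEndpoint : ℕ → Pred Point 0ℓ
IsEndpoint n p = p ≡ origin ⊎ p ≡ corner n

IsMinimalBridge : ℕ → Pred Path 0ℓ
IsMinimalBridge n w =
  IsBridge n w × w ≢ [] × All (λ p → OnDiagonal p → IsEndpoint n p) (latticePoints w)

IsMinimalDuchon : ℕ → Pred Path 0ℓ
IsMinimalDuchon n w =
  IsBridge n w × All (λ p → IsEndpoint n p ⊎ StrictlyAbove p) (latticePoints w)

CrossesDown : Pred (Point × Step) 0ℓ
CrossesDown (p , s) = s ≡ right × OnOrAbove p × StrictlyBelow (p ▷ s)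

-- The first step of the path is exempt from the crossing condition.
IsValved : Pred Path 0ℓ
IsValved w = All (λ e → ¬ CrossesDown e) (drop 1 (locatedSteps w))

IsValvedMinimalBridge : ℕ → Pred Path 0ℓ
IsValvedMinimalBridge n w = IsMinimalBridge n w × IsValved w

_≟ₛ_ : DecidableEquality Step
right ≟ₛ right = yes refl
right ≟ₛ up    = no λ ()
up    ≟ₛ right = no λ ()
up    ≟ₛ up    = yes refl

_≟ₚ_ : DecidableEquality Point
_≟ₚ_ = Product.≡-dec ℕ._≟_ ℕ._≟_

isBridge? : ∀ n → Decidable (IsBridge n)
isBridge? n w = endpoint w ≟ₚ corner n

isEndpoint? : ∀ n → Decidable (IsEndpoint n)
isEndpoint? n p = (p ≟ₚ origin) ⊎-dec (p ≟ₚ corner n)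

isMinimalBridge? : ∀ n → Decidable (IsMinimalBridge n)
isMinimalBridge? n w =
  isBridge? n w ×-dec ¬? (List.≡-dec _≟ₛ_ w []) ×-dec
  all? (λ (x , y) → (3 * y ℕ.≟ 2 * x) →-dec isEndpoint? n (x , y)) (latticePoints w)

isMinimalDuchon? : ∀ n → Decidable (IsMinimalDuchon n)
isMinimalDuchon? n w =
  isBridge? n w ×-dec
  all? (λ (x , y) → isEndpoint? n (x , y) ⊎-dec (2 * x ℕ.<? 3 * y)) (latticePoints w)

crossesDown? : Decidable CrossesDown
crossesDown? ((x , y) , s) =
  (s ≟ₛ right) ×-dec (2 * x ℕ.≤? 3 * y) ×-dec
  (3 * proj₂ ((x , y) ▷ s) ℕ.<? 2 * proj₁ ((x , y) ▷ s))

isValved? : Decidable IsValved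
isValved? w = all? (λ e → ¬? (crossesDown? e)) (drop 1 (locatedSteps w))

isValvedMinimalBridge? : ∀ n → Decidable (IsValvedMinimalBridge n)
isValvedMinimalBridge? n w = isMinimalBridge? n w ×-dec isValved? w

steps : List Step
steps = right ∷ up ∷ []

pathsOfLength : ℕ → List Path
pathsOfLength zero    = [] ∷ []
pathsOfLength (suc m) = cartesianProductWith _∷_ steps (pathsOfLength m)

-- A bridge to (3n,2n) has exactly 5n steps, so for predicates implying
-- IsBridge n these lists contain each such path exactly once; see
-- ∈-bridgesWith and bridgesWith-unique.
bridgesWith : ∀ n {P : Pred Path 0ℓ} → Decidable P → List Path
bridgesWith n P? = filter P? (pathsOfLength (5 * n))

#valvedMinimalBridges : ℕ → ℕ
#valvedMinimalBridges n = length (bridgesWith n (isValvedMinimalBridge? n))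

#minimalDuchonPaths : ℕ → ℕ
#minimalDuchonPaths n = length (bridgesWith n (isMinimalDuchon? n))

∈-pathsOfLength : ∀ w → w ∈ pathsOfLength (length w)
∈-pathsOfLength []      = here refl
∈-pathsOfLength (s ∷ w) = ∈-cartesianProductWith⁺ _∷_ (∈-steps s) (∈-pathsOfLength w)
  where
  ∈-steps : ∀ s → s ∈ steps
  ∈-steps right = here refl
  ∈-steps up    = there (here refl)

pathsOfLength-unique : ∀ m → Unique (pathsOfLength m)
pathsOfLength-unique zero    = [] ∷ []
pathsOfLength-unique (suc m) =
  Unique.cartesianProductWith⁺ _∷_ List.∷-injective
    (((λ ()) ∷ []) ∷ [] ∷ []) (pathsOfLength-unique m)

coordinateSum : Point → ℕ
coordinateSum (x , y) = x + y

coordinateSum-endpointFrom : ∀ p w →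
  coordinateSum (endpointFrom p w) ≡ coordinateSum p + length w
coordinateSum-endpointFrom (x , y) []          = sym (ℕ.+-identityʳ (x + y))
coordinateSum-endpointFrom (x , y) (right ∷ w) =
  trans (coordinateSum-endpointFrom (suc x , y) w) (sym (+-suc (x + y) (length w)))
coordinateSum-endpointFrom (x , y) (up ∷ w)    =
  trans (coordinateSum-endpointFrom (x , suc y) w)
    (trans (cong (_+ length w) (+-suc x y)) (sym (+-suc (x + y) (length w))))

bridge-length : ∀ n w → IsBridge n w → length w ≡ 5 * n
bridge-length n w b = begin
  length w                   ≡⟨ coordinateSum-endpointFrom origin w ⟨
  coordinateSum (endpoint w) ≡⟨ cong coordinateSum b ⟩
  3 * n + 2 * n              ≡⟨ ℕ.*-distribʳ-+ n 3 2 ⟨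
  5 * n                      ∎
  where open ≡-Reasoning

∈-bridgesWith : ∀ n {P : Pred Path 0ℓ} (P? : Decidable P) →
                (∀ {w} → P w → IsBridge n w) →
                ∀ w → w ∈ bridgesWith n P? ⇔ P w
∈-bridgesWith n P? P⇒bridge w = mk⇔
  (λ w∈ → proj₂ (∈-filter⁻ P? {xs = pathsOfLength (5 * n)} w∈))
  (λ Pw → ∈-filter⁺ P?
    (subst (λ m → w ∈ pathsOfLength m) (bridge-length n w (P⇒bridge Pw)) (∈-pathsOfLength w))
    Pw)

bridgesWith-unique : ∀ n {P : Pred Path 0ℓ} (P? : Decidable P) → Unique (bridgesWith n P?)
bridgesWith-unique n P? = Unique.filter⁺ P? (pathsOfLength-unique (5 * n))

instance
  5n∸1-nonZero : ∀ {n} → .{{NonZero n}} → NonZero (5 * n ∸ 1)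
  5n∸1-nonZero {suc m} = subst NonZero (sym (+-suc m _)) _

{-# OPTIONS --safe #-}
module Submission where

-- Measure positions by the height 3y − 2x, so that up is +3 and right is −2. By
-- its first step and its last step to height 0, a valved minimal bridge is
-- positive (D of these), negative (again D by reversal), or starts negative and
-- crosses 0 once, by −2 → 1 or −1 → 2. Reversing the negative part, the crossing
-- bridges of either kind are counted by the convolution Y of the first-passage
-- numbers 1 ⇝ 0 and 2 ⇝ 0, so the total is 2D + 2Y. Let G count the positive walks
-- 2 ⇝ 1 of length 5n − 2. Removing the end steps of a minimal Duchon path leaves a
-- positive walk 3 ⇝ 2, which either avoids height 1 (G of these) or splits at its
-- first visit there (Y of these): D = G + Y, and the total is 6D − 2(D + G).
--
-- Finally (5n − 1)(D + G) = 2 C(5n − 1, 2n). Instead of a cycle lemma, the first-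
-- and last-step expansions of the same walk numbers are summed over all starting
-- heights; the sum telescopes, and at large heights positivity is no constraint, so
-- only binomial coefficients are left there: D + G = 3 C(5n − 2, 2n − 1) − 2 C(5n − 2, 2n).

open import Defs
open import Data.Bool.Base using (true; false)
import Data.Integer.Base as ℤ
import Data.Integer.Properties as ℤ
open import Data.List.Base using ([]; _∷_; filter; length; map; _++_)
import Data.List.Properties as List
open import Data.List.Relation.Unary.All as All using (All; []; _∷_)
open import Data.Nat.Base
open import Data.Nat.Combinatorics
open import Data.Nat.Properties
open import Data.Nat.Tactic.RingSolver using (solve-∀)
open import Data.Product.Base using (_×_; _,_; proj₁; proj₂)
import Data.Rational.Base as ℚ
import Data.Rational.Properties as ℚ
import Data.Rational.Unnormalised.Base as ℚᵘ
import Data.Rational.Unnormalised.Properties as ℚᵘ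
open import Data.Sum.Base using (_⊎_; inj₁; inj₂)
open import Function.Base using (_∘_)
open import Function.Bundles using (_⇔_; mk⇔; Equivalence)
open import Level using (0ℓ)
open import Relation.Binary.Definitions using (tri<; tri≈; tri>)
open import Relation.Binary.PropositionalEquality
open import Relation.Nullary using (¬_; contradiction; does)
open import Relation.Unary using (Pred; Decidable)

-- Kronecker delta and truncated shifts.

δ : ℕ → ℕ → ℕ
δ zero    zero    = 1
δ zero    (suc b) = 0
δ (suc a) zero    = 0
δ (suc a) (suc b) = δ a b

δ-diag : ∀ a → δ a a ≡ 1
δ-diag zero    = refl
δ-diag (suc a) = δ-diag a

δ-≢ : ∀ {a b} → a ≢ b → δ a b ≡ 0
δ-≢ {zero}  {zero}  a≢b = contradiction refl a≢b
δ-≢ {zero}  {suc b} a≢b = refl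
δ-≢ {suc a} {zero}  a≢b = refl
δ-≢ {suc a} {suc b} a≢b = δ-≢ (a≢b ∘ cong suc)

-- Encodes a step down by `k` that is killed at the boundary: index `i` stands for height i + 1, and
-- for i < k the step would leave the positive heights.
lower : ℕ → (ℕ → ℕ) → ℕ → ℕ
lower zero    f i       = f i
lower (suc k) f zero    = 0
lower (suc k) f (suc i) = lower k f i

lower-cong : ∀ k {f g : ℕ → ℕ} → (∀ i → f i ≡ g i) → ∀ i → lower k f i ≡ lower k g i
lower-cong zero    f≗g i       = f≗g i
lower-cong (suc k) f≗g zero    = refl
lower-cong (suc k) f≗g (suc i) = lower-cong k f≗g i

lower-+ : ∀ k (f g : ℕ → ℕ) i → lower k (λ j → f j + g j) i ≡ lower k f i + lower k g i
lower-+ zero    f g i       = refl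
lower-+ (suc k) f g zero    = refl
lower-+ (suc k) f g (suc i) = lower-+ k f g i

lower-0 : ∀ k i → lower k (λ _ → 0) i ≡ 0
lower-0 zero    i       = refl
lower-0 (suc k) zero    = refl
lower-0 (suc k) (suc i) = lower-0 k i

-- Shifts of the start and of the end act on different arguments; the induction for `walks-lastStep`
-- exchanges first and last steps this way.
lower-swap : ∀ k l (f : ℕ → ℕ → ℕ) i j →
  lower k (λ a → lower l (f a) j) i ≡ lower l (λ b → lower k (λ a → f a b) i) j
lower-swap zero    l f i       j = refl
lower-swap (suc k) l f zero    j = sym (lower-0 l j)
lower-swap (suc k) l f (suc i) j = lower-swap k l f i j

-- Positive walks and their two step expansions.

-- walks m a b counts the sequences of m steps +2 and −3 that lead from a + 1
-- to b + 1 through positive integers only.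
walks : ℕ → ℕ → ℕ → ℕ
walks zero    a b = δ a b
walks (suc m) a b = walks m (2 + a) b + lower 3 (λ c → walks m c b) a

-- With `δ-lowerʳ`, moves a shift between start and end: a walk of one step has the same step as its
-- first and its last.
δ-lowerˡ : ∀ k a b → lower k (λ c → δ c b) a ≡ δ a (k + b)
δ-lowerˡ zero    a       b = refl
δ-lowerˡ (suc k) zero    b = refl
δ-lowerˡ (suc k) (suc a) b = δ-lowerˡ k a b

δ-lowerʳ : ∀ k a b → lower k (δ a) b ≡ δ (k + a) b
δ-lowerʳ zero    a b       = refl
δ-lowerʳ (suc k) a zero    = refl
δ-lowerʳ (suc k) a (suc b) = δ-lowerʳ k a b

-- Read backwards, this says that walks m b a also counts the positive walks
-- from a + 1 to b + 1 with steps +3 and −2.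
walks-lastStep : ∀ m a b → walks (suc m) a b ≡ lower 2 (walks m a) b + walks m a (3 + b)
walks-lastStep zero    a b =
  cong₂ _+_ (sym (δ-lowerʳ 2 a b)) (δ-lowerˡ 3 a b)
walks-lastStep (suc m) a b = begin
  walks (suc m) (2 + a) b + lower 3 (λ c → walks (suc m) c b) a
    ≡⟨ cong₂ _+_ (walks-lastStep m (2 + a) b)
         (trans (lower-cong 3 (λ c → walks-lastStep m c b) a) (lower-+ 3 _ _ a)) ⟩
  (lower 2 (walks m (2 + a)) b + walks m (2 + a) (3 + b))
    + (lower 3 (λ c → lower 2 (walks m c) b) a + lower 3 (λ c → walks m c (3 + b)) a)
    ≡⟨ +-interchange (lower 2 (walks m (2 + a)) b) _ _ _ ⟩
  (lower 2 (walks m (2 + a)) b + lower 3 (λ c → lower 2 (walks m c) b) a)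
    + walks (suc m) a (3 + b)
    ≡⟨ cong (λ z → (lower 2 (walks m (2 + a)) b + z) + walks (suc m) a (3 + b))
         (lower-swap 3 2 (walks m) a b) ⟩
  (lower 2 (walks m (2 + a)) b + lower 2 (λ d → lower 3 (λ c → walks m c d) a) b)
    + walks (suc m) a (3 + b)
    ≡⟨ cong (_+ walks (suc m) a (3 + b)) (lower-+ 2 (walks m (2 + a)) _ b) ⟨
  lower 2 (walks (suc m) a) b + walks (suc m) a (3 + b) ∎
  where
  open ≡-Reasoning
  +-interchange : ∀ w x y z → (w + x) + (y + z) ≡ (w + y) + (x + z)
  +-interchange = solve-∀

-- Convolution of sequences.

conv : (ℕ → ℕ) → (ℕ → ℕ) → ℕ → ℕ
conv f g zero    = f 0 * g 0
conv f g (suc m) = f 0 * g (suc m) + conv (f ∘ suc) g m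

conv-congˡ : ∀ {f f′ : ℕ → ℕ} g m → (∀ i → f i ≡ f′ i) → conv f g m ≡ conv f′ g m
conv-congˡ g zero    f≗f′ = cong (_* g 0) (f≗f′ 0)
conv-congˡ g (suc m) f≗f′ =
  cong₂ _+_ (cong (_* g (suc m)) (f≗f′ 0)) (conv-congˡ g m (f≗f′ ∘ suc))

conv-+ˡ : ∀ (f f′ g : ℕ → ℕ) m → conv (λ i → f i + f′ i) g m ≡ conv f g m + conv f′ g m
conv-+ˡ f f′ g zero    = *-distribʳ-+ (g 0) (f 0) (f′ 0)
conv-+ˡ f f′ g (suc m) = trans (cong ((f 0 + f′ 0) * g (suc m) +_) (conv-+ˡ (f ∘ suc) (f′ ∘ suc) g m))
  (rearrange (f 0) (f′ 0) (g (suc m)) _ _)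
  where
  rearrange : ∀ x y z u v → (x + y) * z + (u + v) ≡ (x * z + u) + (y * z + v)
  rearrange = solve-∀

conv-0ˡ : ∀ g m → conv (λ _ → 0) g m ≡ 0
conv-0ˡ g zero    = refl
conv-0ˡ g (suc m) = conv-0ˡ g m

conv-δˡ : ∀ g m → conv (λ i → δ i 0) g m ≡ g m
conv-δˡ g zero    = +-identityʳ (g 0)
conv-δˡ g (suc m) = trans (cong₂ _+_ (+-identityʳ (g (suc m))) (conv-0ˡ g m)) (+-identityʳ _)

-- Peels off the term at the other end of the sum, which gives commutativity and removes a vanishing
-- last term.
conv-sucʳ : ∀ (f g : ℕ → ℕ) m → conv f g (suc m) ≡ conv f (g ∘ suc) m + f (suc m) * g 0
conv-sucʳ f g zero    = refl
conv-sucʳ f g (suc m) = trans (cong (f 0 * g (2 + m) +_) (conv-sucʳ (f ∘ suc) g m))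
  (sym (+-assoc (f 0 * g (2 + m)) _ _))

conv-comm : ∀ (f g : ℕ → ℕ) m → conv f g m ≡ conv g f m
conv-comm f g zero    = *-comm (f 0) (g 0)
conv-comm f g (suc m) = trans (cong₂ _+_ (*-comm (f 0) (g (suc m))) (conv-comm (f ∘ suc) g m))
  (trans (+-comm (g (suc m) * f 0) _) (sym (conv-sucʳ g f m)))

-- First passages to height 0.

-- The number of walks with m steps +3 and −2 from a + 1 to 0 that are positive
-- before their last step, which is then 2 → 0.
firstPassages : ℕ → ℕ → ℕ
firstPassages zero    a = 0
firstPassages (suc m) a = walks m 1 a

-- Continuations of length `m` after a step -2 from height a + 1: from 1 the step is a forbidden
-- crossing, and from 2 it reaches 0, where the walk has to end.
afterRight : ℕ → ℕ → ℕ
afterRight m 0             = 0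
afterRight m 1             = δ m 0
afterRight m (suc (suc a)) = firstPassages m a

-- Splits by the first step of the passage. `firstPassages` reads `walks` backwards, so this is the
-- last step there.
firstPassages-step : ∀ m a → firstPassages (suc m) a ≡ firstPassages m (3 + a) + afterRight m a
firstPassages-step zero    0             = refl
firstPassages-step zero    1             = refl
firstPassages-step zero    (suc (suc a)) = refl
firstPassages-step (suc m) a = trans (walks-lastStep m 1 a)
  (trans (+-comm (lower 2 (walks m 1) a) _) (cong (walks m 1 (3 + a) +_) (lower≡afterRight a)))
  where
  lower≡afterRight : ∀ a → lower 2 (walks m 1) a ≡ afterRight (suc m) a
  lower≡afterRight 0             = refl
  lower≡afterRight 1             = refl
  lower≡afterRight (suc (suc a)) = refl

-- Split at the first visit to height 1.
walks-shift : ∀ m b a → walks m (suc b) (suc a) ≡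
  walks m b a + conv (λ i → firstPassages i a) (λ i → walks i (suc b) 0) m
walks-shift zero    b a = sym (+-identityʳ (δ b a))
walks-shift (suc m) b a = begin
  walks (suc m) (suc b) (suc a)
    ≡⟨ walks-lastStep m (suc b) (suc a) ⟩
  lower 1 (walks m (suc b)) a + walks m (suc b) (4 + a)
    ≡⟨ cong₂ _+_ (afterRight-shift a) (walks-shift m b (3 + a)) ⟩
  (lower 2 (walks m b) a + conv (λ i → afterRight i a) g m)
    + (walks m b (3 + a) + conv (λ i → firstPassages i (3 + a)) g m)
    ≡⟨ rearrange (lower 2 (walks m b) a) _ _ _ ⟩
  (lower 2 (walks m b) a + walks m b (3 + a))
    + (conv (λ i → firstPassages i (3 + a)) g m + conv (λ i → afterRight i a) g m)
    ≡⟨ cong₂ _+_ (walks-lastStep m b a) (conv-+ˡ (λ i → firstPassages i (3 + a)) _ g m) ⟨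
  walks (suc m) b a + conv (λ i → firstPassages i (3 + a) + afterRight i a) g m
    ≡⟨ cong (walks (suc m) b a +_) (conv-congˡ g m (λ i → firstPassages-step i a)) ⟨
  walks (suc m) b a + conv (λ i → firstPassages i a) g (suc m) ∎
  where
  open ≡-Reasoning
  g : ℕ → ℕ
  g i = walks i (suc b) 0
  rearrange : ∀ x y z w → (x + y) + (z + w) ≡ (x + z) + (w + y)
  rearrange = solve-∀
  afterRight-shift : ∀ a → lower 1 (walks m (suc b)) a ≡
    lower 2 (walks m b) a + conv (λ i → afterRight i a) g m
  afterRight-shift 0             = sym (conv-0ˡ g m)
  afterRight-shift 1             = sym (conv-δˡ g m)
  afterRight-shift (suc (suc a)) = walks-shift m b a

-- Walks that cross from below.

-- The number of walks with m steps +3 and −2 from −(a + 1) to 0 that avoid 0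
-- before the end and never go from a positive to a negative height. Such a walk
-- arrives at 0 from below or crosses once, by a step −1 → 2 or −2 → 1.
crossings : ℕ → ℕ → ℕ
crossings zero    a = 0
crossings (suc m) a = walks m a 2
  + (conv (λ i → walks i a 0) (λ i → firstPassages i 1) m
  +  conv (λ i → walks i a 1) (λ i → firstPassages i 0) m)

-- Continuations of length `m` after a step +3 from -(a + 1), which lands at 2 - a: at 2, 1, 0 or
-- still below.
afterUp : ℕ → ℕ → ℕ
afterUp m 0                   = firstPassages m 1
afterUp m 1                   = firstPassages m 0
afterUp m 2                   = δ m 0
afterUp m (suc (suc (suc a))) = crossings m a

crossings-step : ∀ m a → crossings (suc m) a ≡ crossings m (2 + a) + afterUp m a
crossings-step zero 0                   = refl
crossings-step zero 1                   = refl
crossings-step zero 2                   = refl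
crossings-step zero (suc (suc (suc a))) = refl
crossings-step (suc m) a = begin
  walks m (2 + a) 2 + lower 3 (λ c → walks m c 2) a
    + ((δ a 0 * F 1 (suc m) + conv (λ i → walks (suc i) a 0) (F 1) m)
    +  (δ a 1 * F 0 (suc m) + conv (λ i → walks (suc i) a 1) (F 0) m))
    -- The terms with `δ a 0` and `δ a 1` cross at once; all others split by their first step, and
    -- `low` collects those that begin with +3.
    ≡⟨ cong₂ (λ x y → walks (suc m) a 2 + ((δ a 0 * F 1 (suc m) + x) + (δ a 1 * F 0 (suc m) + y)))
         (conv-+ˡ (λ i → walks i (2 + a) 0) _ (F 1) m)
         (conv-+ˡ (λ i → walks i (2 + a) 1) _ (F 0) m) ⟩
  walks m (2 + a) 2 + lower 3 (λ c → walks m c 2) a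
    + ((δ a 0 * F 1 (suc m) + (conv (λ i → walks i (2 + a) 0) (F 1) m + low 0 (F 1) a))
    +  (δ a 1 * F 0 (suc m) + (conv (λ i → walks i (2 + a) 1) (F 0) m + low 1 (F 0) a)))
    ≡⟨ rearrange (walks m (2 + a) 2) (lower 3 (λ c → walks m c 2) a) (δ a 0 * F 1 (suc m)) _ _
         (δ a 1 * F 0 (suc m)) _ _ ⟩
  crossings (suc m) (2 + a)
    + (lower 3 (λ c → walks m c 2) a
    + ((δ a 0 * F 1 (suc m) + low 0 (F 1) a) + (δ a 1 * F 0 (suc m) + low 1 (F 0) a)))
    ≡⟨ cong (crossings (suc m) (2 + a) +_) (up≡ a) ⟩
  crossings (suc m) (2 + a) + afterUp (suc m) a ∎
  where
  open ≡-Reasoning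
  F : ℕ → ℕ → ℕ
  F b i = firstPassages i b
  low : ℕ → (ℕ → ℕ) → ℕ → ℕ
  low b g a = conv (λ i → lower 3 (λ c → walks i c b) a) g m
  rearrange : ∀ p q r s t u v w →
    p + q + ((r + (s + t)) + (u + (v + w))) ≡ (p + (s + v)) + (q + ((r + t) + (u + w)))
  rearrange = solve-∀
  up≡ : ∀ a → lower 3 (λ c → walks m c 2) a
    + ((δ a 0 * F 1 (suc m) + low 0 (F 1) a) + (δ a 1 * F 0 (suc m) + low 1 (F 0) a))
    ≡ afterUp (suc m) a
  up≡ 0 rewrite conv-0ˡ (F 1) m | conv-0ˡ (F 0) m = drop-zeros (F 1 (suc m))
    where
    drop-zeros : ∀ x → (x + 0) + 0 + 0 ≡ x
    drop-zeros = solve-∀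
  up≡ 1 rewrite conv-0ˡ (F 1) m | conv-0ˡ (F 0) m = drop-zeros (F 0 (suc m))
    where
    drop-zeros : ∀ x → (x + 0) + 0 ≡ x
    drop-zeros = solve-∀
  up≡ 2 rewrite conv-0ˡ (F 1) m | conv-0ˡ (F 0) m = refl
  up≡ (suc (suc (suc a))) = refl

-- When `suc k` is 5n - 2, `w`, `v` and `z` are D, G and Y. The walks counted by `crossings` amount
-- to D + 2Y, and D = G + Y eliminates Y.
crossings-formula : ∀ k → crossings (2 + k) 1 + 2 * walks (suc k) 0 1 ≡ 3 * walks (suc k) 1 2
crossings-formula k = begin
  w + (x + y) + 2 * v  ≡⟨ cong₂ (λ x y → w + (x + y) + 2 * v) x≡z y≡z ⟩
  w + (z + z) + 2 * v  ≡⟨ rearrange w z v ⟩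
  w + 2 * (v + z)      ≡⟨ cong (λ u → w + 2 * u) (walks-shift (suc k) 0 1) ⟨
  w + 2 * w            ∎
  where
  open ≡-Reasoning
  w x y z v : ℕ
  w = walks (suc k) 1 2
  v = walks (suc k) 0 1
  x = conv (λ i → walks i 1 0) (λ i → firstPassages i 1) (suc k)
  y = conv (λ i → walks i 1 1) (λ i → firstPassages i 0) (suc k)
  z = conv (λ i → firstPassages i 1) (λ i → walks i 1 0) (suc k)
  x≡z : x ≡ z
  x≡z = conv-comm (λ i → walks i 1 0) (λ i → firstPassages i 1) (suc k)
  y≡z : y ≡ z
  -- No first passage has length 0, so `y` loses its last term and `z` its first. What is left is
  -- the same convolution of `walks i 1 1` and `walks i 1 0`.
  y≡z = trans (conv-sucʳ (λ i → walks i 1 1) (λ i → firstPassages i 0) k)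
    (trans (cong (conv (λ i → walks i 1 1) (λ i → walks i 1 0) k +_) (*-zeroʳ (walks (suc k) 1 1)))
      (+-identityʳ _))
  rearrange : ∀ w z v → w + (z + z) + 2 * v ≡ w + 2 * (v + z)
  rearrange = solve-∀

-- Telescoping over the starting heights.

-- Equate the first-step and the last-step expansions of walks (suc k) (i + 4) (i + 2),
-- and telescope over i.
walks-telescope : ∀ k i →
  (walks k 0 1 + walks k 1 2) + (walks k (4 + i) i + walks k (5 + i) (1 + i)) ≡
  walks k (1 + i) (2 + i) + walks k (2 + i) (3 + i) + walks k (3 + i) (4 + i)
walks-telescope k zero = begin
  (α 0 + α 1) + (β 0 + β 1)        ≡⟨ rearrange (α 0) (α 1) (β 0) (β 1) ⟩
  -- The ends `0` and `1` are too low to be reached by a last step +2, and the start `2` is too low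
  -- for a first step -3; the boundary values `α 0` and `α 1` come from these missing terms.
  α 1 + β 0 + (β 1 + α 0)          ≡⟨ cong₂ (λ x y → α 1 + x + y)
                                        (trans (sym (+-identityʳ (β 0))) (walks-lastStep k 2 0))
                                        (walks-lastStep k 3 1) ⟩
  α 1 + α 2 + α 3                  ∎
  where
  open ≡-Reasoning
  α β : ℕ → ℕ
  α i = walks k i (1 + i)
  β i = walks k (4 + i) i
  rearrange : ∀ x y z w → (x + y) + (z + w) ≡ y + z + (w + x)
  rearrange = solve-∀
walks-telescope k (suc i) = +-cancelʳ-≡ (β i) _ _ (begin
  s + (β (1 + i) + β (2 + i)) + β i              ≡⟨ rearrange₁ s (β (1 + i)) (β (2 + i)) (β i) ⟩
  s + (β i + β (1 + i)) + β (2 + i)              ≡⟨ cong (_+ β (2 + i)) (walks-telescope k i) ⟩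
  α (1 + i) + α (2 + i) + α (3 + i) + β (2 + i)  ≡⟨ rearrange₂ (α (1 + i)) (α (2 + i)) (α (3 + i)) _ ⟩
  α (2 + i) + α (3 + i) + (β (2 + i) + α (1 + i))
    ≡⟨ cong (α (2 + i) + α (3 + i) +_) (walks-lastStep k (4 + i) (2 + i)) ⟩
  α (2 + i) + α (3 + i) + (β i + α (4 + i))      ≡⟨ rearrange₃ (α (2 + i)) (α (3 + i)) (β i) _ ⟩
  α (2 + i) + α (3 + i) + α (4 + i) + β i        ∎)
  where
  open ≡-Reasoning
  α β : ℕ → ℕ
  α i = walks k i (1 + i)
  β i = walks k (4 + i) i
  s : ℕ
  s = α 0 + α 1
  rearrange₁ : ∀ s x y z → s + (x + y) + z ≡ s + (z + x) + y
  rearrange₁ = solve-∀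
  rearrange₂ : ∀ x y z w → x + y + z + w ≡ y + z + (w + x)
  rearrange₂ = solve-∀
  rearrange₃ : ∀ x y z w → x + y + (z + w) ≡ x + y + w + z
  rearrange₃ = solve-∀

-- Unconstrained walks and binomial coefficients.

a+2[1+m]≡2+a+2m : ∀ a m → a + 2 * suc m ≡ 2 + a + 2 * m
a+2[1+m]≡2+a+2m = solve-∀

walks-unreachable : ∀ m a b → a + 2 * m < b → walks m a b ≡ 0
walks-unreachable zero    a b a<b = δ-≢ (<⇒≢ (subst (_< b) (+-identityʳ a) a<b))
walks-unreachable (suc m) a b a<b = cong₂ _+_
  (walks-unreachable m (2 + a) b (subst (_< b) (a+2[1+m]≡2+a+2m a m) a<b)) (low a a<b)
  where
  low : ∀ a → a + 2 * suc m < b → lower 3 (λ c → walks m c b) a ≡ 0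
  low 0                   _   = refl
  low 1                   _   = refl
  low 2                   _   = refl
  low (suc (suc (suc c))) c<b = walks-unreachable m c b
    (≤-<-trans (+-mono-≤ (m≤n+m c 3) (*-monoʳ-≤ 2 (n≤1+n m))) c<b)

-- From a start a + 1 > 3u a walk with u steps −3 cannot reach 0, so the order of
-- the steps is arbitrary.
walks-free : ∀ m u a b → 3 * u ≤ a → a + 2 * m ≡ b + 5 * u → walks m a b ≡ m C u
walks-free zero zero a b _ eq
  rewrite trans (sym (+-identityʳ a)) (trans eq (+-identityʳ b)) = δ-diag b
walks-free zero (suc u) a b _ eq = δ-≢ {a} {b} λ { refl →
  m≢1+m+n a (trans (trans (sym (+-identityʳ a)) eq) (+-suc a _)) }
walks-free (suc m) zero a b _ eq = cong₂ _+_
  (walks-free m zero (2 + a) b z≤n (trans (sym (a+2[1+m]≡2+a+2m a m)) eq))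
  (low a (trans eq (+-identityʳ b)))
  where
  low : ∀ a → a + 2 * suc m ≡ b → lower 3 (λ c → walks m c b) a ≡ 0
  low 0                   _  = refl
  low 1                   _  = refl
  low 2                   _  = refl
  low (suc (suc (suc c))) eq = walks-unreachable m c b
    (<-≤-trans (+-mono-<-≤ (m≤n+m (suc c) 2) (*-monoʳ-≤ 2 (n≤1+n m))) (≤-reflexive eq))
walks-free (suc m) (suc u) a b 3u≤a eq = step a (subst (_≤ a) (*-suc 3 u) 3u≤a) eq
  where
  down : ∀ c m → 3 + c + 2 * suc m ≡ 5 + (c + 2 * m)
  down = solve-∀
  down′ : ∀ b u → b + 5 * suc u ≡ 5 + (b + 5 * u)
  down′ = solve-∀
  -- The length equation says how many steps are -3, each costing 5 against a step +2. The bound on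
  -- `a` leaves room for a first step -3, and the two first steps add up by Pascal's rule.
  step : ∀ a → 3 + 3 * u ≤ a → a + 2 * suc m ≡ b + 5 * suc u → walks (suc m) a b ≡ suc m C suc u
  step (suc (suc (suc c))) 3u≤c@(s≤s (s≤s (s≤s _))) eq = begin
    walks m (5 + c) b + walks m c b  ≡⟨ cong₂ _+_
      (walks-free m (suc u) (5 + c) b
        (≤-trans (≤-reflexive (*-suc 3 u)) (≤-trans 3u≤c (m≤n+m (3 + c) 2)))
        (trans (sym (a+2[1+m]≡2+a+2m (3 + c) m)) eq))
      (walks-free m u c b (+-cancelˡ-≤ 3 _ _ 3u≤c)
        (+-cancelˡ-≡ 5 _ _ (trans (sym (down c m)) (trans eq (down′ b u))))) ⟩
    m C suc u + m C u                ≡⟨ +-comm (m C suc u) (m C u) ⟩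
    m C u + m C suc u                ≡⟨ nCk+nC[k+1]≡[n+1]C[k+1] m u ⟩
    suc m C suc u                    ∎
    where open ≡-Reasoning

-- Induction on `n`, with Pascal's rule once to split and once to recombine.
C-absorption : ∀ n k → suc k * (suc n C suc k) ≡ suc n * (n C k)
C-absorption zero    zero    = refl
C-absorption zero    (suc k) = trans (cong (suc (suc k) *_) (k>n⇒nCk≡0 {1} {2 + k} (s≤s (s≤s z≤n))))
  (trans (*-zeroʳ (2 + k)) (sym (cong (1 *_) (k>n⇒nCk≡0 {0} {suc k} (s≤s z≤n)))))
C-absorption (suc n) zero    = trans (cong (1 *_) (nC1≡n (2 + n))) (trans (*-identityˡ _) (sym (*-identityʳ _)))
C-absorption (suc n) (suc k) = begin
  (2 + k) * (suc (suc n) C suc (suc k))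
    ≡⟨ cong ((2 + k) *_) (nCk+nC[k+1]≡[n+1]C[k+1] (suc n) (suc k)) ⟨
  (2 + k) * (suc n C suc k + suc n C suc (suc k))
    ≡⟨ expand k (suc n C suc k) _ ⟩
  suc n C suc k + (suc k * (suc n C suc k) + (2 + k) * (suc n C suc (suc k)))
    ≡⟨ cong (suc n C suc k +_) (cong₂ _+_ (C-absorption n k) (C-absorption n (suc k))) ⟩
  suc n C suc k + (suc n * (n C k) + suc n * (n C suc k))
    ≡⟨ cong (suc n C suc k +_) (*-distribˡ-+ (suc n) (n C k) _) ⟨
  suc n C suc k + suc n * (n C k + n C suc k)
    ≡⟨ cong (λ z → suc n C suc k + suc n * z) (nCk+nC[k+1]≡[n+1]C[k+1] n k) ⟩
  (2 + n) * (suc n C suc k) ∎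
  where
  open ≡-Reasoning
  expand : ∀ k x y → (2 + k) * (x + y) ≡ x + (suc k * x + (2 + k) * y)
  expand = solve-∀

-- With k + 1 = 5n − 1 steps +2 and −3, of which 2n are −3, the total
-- displacement is −2.
walks-cycle : ∀ k n′ → 2 + k ≡ 5 * suc n′ →
  suc k * (walks k 0 1 + walks k 1 2) ≡ 2 * (suc k C (2 * suc n′))
-- The telescoped sum gives s = 3c - 2d. Adding `2 * (N * e)`, where e = c + d, avoids subtraction
-- and leaves `5 * (N * c)` for the absorption identity.
walks-cycle k n′ 2+k≡5n = +-cancelʳ-≡ (2 * (N * e)) _ _ (begin
  N * s + 2 * (N * e)          ≡⟨ cong (λ z → N * s + 2 * (N * z)) e≡c+d ⟩
  N * s + 2 * (N * (c + d))    ≡⟨ rearrange₁ N s c d ⟩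
  N * (s + (d + d)) + 2 * (N * c)  ≡⟨ cong (λ z → N * z + 2 * (N * c)) telescoped ⟩
  N * (c + c + c) + 2 * (N * c)    ≡⟨ rearrange₂ N c ⟩
  5 * (N * c)                  ≡⟨ cong (5 *_) (C-absorption k u) ⟨
  5 * (suc u * (N C suc u))    ≡⟨ cong (λ j → 5 * (j * (N C j))) u+1≡2n ⟩
  5 * (2 * suc n′ * e)         ≡⟨ rearrange₃ (suc n′) e ⟩
  2 * (5 * suc n′ * e)         ≡⟨ cong (λ z → 2 * (z * e)) 2+k≡5n ⟨
  2 * ((1 + N) * e)            ≡⟨ *-distribˡ-+ 2 e (N * e) ⟩
  2 * e + 2 * (N * e)          ∎)
  where
  open ≡-Reasoning
  N u i s c d e : ℕ
  N = suc k
  u = 1 + 2 * n′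
  -- Walks of length `k` from j to 1 + j have 2n - 1 steps -3, those from 4 + j to j have 2n. With
  -- `suc u` = 2n, both kinds are unconstrained from this index on.
  i = 3 * suc u
  s = walks k 0 1 + walks k 1 2
  c = k C u
  d = k C suc u
  e = N C (2 * suc n′)
  u+1≡2n : suc u ≡ 2 * suc n′
  u+1≡2n = sym (*-suc 2 n′)
  e≡c+d : e ≡ c + d
  e≡c+d = trans (cong (N C_) (sym u+1≡2n)) (sym (nCk+nC[k+1]≡[n+1]C[k+1] k u))
  α-free : ∀ j → 3 * u ≤ j → walks k j (1 + j) ≡ c
  α-free j 3u≤j = walks-free k u j (1 + j) 3u≤j (+-cancelˡ-≡ 4 _ _ (begin
    4 + (j + 2 * k)              ≡⟨ lhs j k ⟩
    j + 2 * (2 + k)              ≡⟨ cong (λ z → j + 2 * z) 2+k≡5n ⟩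
    j + 2 * (5 * suc n′)         ≡⟨ rhs j n′ ⟩
    4 + (1 + j + 5 * (1 + 2 * n′)) ∎))
    where
    lhs : ∀ j k → 4 + (j + 2 * k) ≡ j + 2 * (2 + k)
    lhs = solve-∀
    rhs : ∀ j n′ → j + 2 * (5 * suc n′) ≡ 4 + (1 + j + 5 * (1 + 2 * n′))
    rhs = solve-∀
  β-free : ∀ j → 3 * suc u ≤ j → walks k (4 + j) j ≡ d
  β-free j 3u≤j = walks-free k (suc u) (4 + j) j (≤-trans 3u≤j (m≤n+m j 4)) (begin
    4 + j + 2 * k                ≡⟨ lhs j k ⟩
    j + 2 * (2 + k)              ≡⟨ cong (λ z → j + 2 * z) 2+k≡5n ⟩
    j + 2 * (5 * suc n′)         ≡⟨ rhs j n′ ⟩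
    j + 5 * (2 + 2 * n′)         ∎)
    where
    lhs : ∀ j k → 4 + j + 2 * k ≡ j + 2 * (2 + k)
    lhs = solve-∀
    rhs : ∀ j n′ → j + 2 * (5 * suc n′) ≡ j + 5 * (2 + 2 * n′)
    rhs = solve-∀
  3u≤i : 3 * u ≤ i
  3u≤i = *-monoʳ-≤ 3 (n≤1+n u)
  telescoped : s + (d + d) ≡ c + c + c
  telescoped = begin
    s + (d + d)
      ≡⟨ cong₂ (λ x y → s + (x + y)) (β-free i ≤-refl) (β-free (1 + i) (n≤1+n i)) ⟨
    s + (walks k (4 + i) i + walks k (5 + i) (1 + i))
      ≡⟨ walks-telescope k i ⟩
    walks k (1 + i) (2 + i) + walks k (2 + i) (3 + i) + walks k (3 + i) (4 + i)
      ≡⟨ cong₂ _+_ (cong₂ _+_ (α-free (1 + i) (≤-trans 3u≤i (m≤n+m i 1)))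
           (α-free (2 + i) (≤-trans 3u≤i (m≤n+m i 2)))) (α-free (3 + i) (≤-trans 3u≤i (m≤n+m i 3))) ⟩
    c + c + c ∎
  rearrange₁ : ∀ N s c d → N * s + 2 * (N * (c + d)) ≡ N * (s + (d + d)) + 2 * (N * c)
  rearrange₁ = solve-∀
  rearrange₂ : ∀ N c → N * (c + c + c) + 2 * (N * c) ≡ 5 * (N * c)
  rearrange₂ = solve-∀
  rearrange₃ : ∀ n e → 5 * (2 * n * e) ≡ 2 * (5 * n * e)
  rearrange₃ = solve-∀

-- Counting step lists by their first step.

private variable
  P Q : Pred Path 0ℓ

count : Decidable P → ℕ → ℕ
count P? m = length (filter P? (pathsOfLength m))

length-filter-map : (P? : Decidable P) (f : Path → Path) → ∀ ws →
  length (filter P? (map f ws)) ≡ length (filter (P? ∘ f) ws)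
length-filter-map P? f []       = refl
length-filter-map P? f (w ∷ ws) with does (P? (f w))
... | true  = cong suc (length-filter-map P? f ws)
... | false = length-filter-map P? f ws

count-suc : (P? : Decidable P) → ∀ m →
  count P? (suc m) ≡ count (P? ∘ (right ∷_)) m + count (P? ∘ (up ∷_)) m
count-suc P? m = begin
  length (filter P? (map (right ∷_) ws ++ map (up ∷_) ws ++ []))
    ≡⟨ cong (λ l → length (filter P? (map (right ∷_) ws ++ l))) (List.++-identityʳ _) ⟩
  length (filter P? (map (right ∷_) ws ++ map (up ∷_) ws))
    ≡⟨ cong length (List.filter-++ P? (map (right ∷_) ws) _) ⟩
  length (filter P? (map (right ∷_) ws) ++ filter P? (map (up ∷_) ws))
    ≡⟨ List.length-++ (filter P? (map (right ∷_) ws)) ⟩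
  length (filter P? (map (right ∷_) ws)) + length (filter P? (map (up ∷_) ws))
    ≡⟨ cong₂ _+_ (length-filter-map P? (right ∷_) ws) (length-filter-map P? (up ∷_) ws) ⟩
  count (P? ∘ (right ∷_)) m + count (P? ∘ (up ∷_)) m ∎
  where
  open ≡-Reasoning
  ws = pathsOfLength m

count-none : (P? : Decidable P) → ∀ m → (∀ w → ¬ P w) → count P? m ≡ 0
count-none P? m ¬P = cong length (List.filter-none P? (All.universal ¬P (pathsOfLength m)))

All-latticePoints-head : ∀ {A : Pred Point 0ℓ} p w → All A (latticePointsFrom p w) → A p
All-latticePoints-head p []      (a ∷ _) = a
All-latticePoints-head p (_ ∷ _) (a ∷ _) = a

infix 4 _≗⇔_
-- Splitting off a step precomposes the decision procedure with `s ∷_`. The counts are therefore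
-- stated for every decidable predicate equivalent to the intended one.
_≗⇔_ : Pred Path 0ℓ → Pred Path 0ℓ → Set
P ≗⇔ Q = ∀ w → P w ⇔ Q w

-- Lattice paths as walks of heights.

module Bridges (n : ℕ) where

  -- The conditions on the part of a valved minimal bridge that starts at p, when p
  -- is not the origin.
  Continues : Point → Pred Path 0ℓ
  Continues p w = endpointFrom p w ≡ corner n
    × All (λ q → OnDiagonal q → IsEndpoint n q) (latticePointsFrom p w)
    × All (λ e → ¬ CrossesDown e) (locatedStepsFrom p w)

  continues-step : ∀ {p s w} → (OnDiagonal p → IsEndpoint n p) → ¬ CrossesDown (p , s) →
    Continues p (s ∷ w) ⇔ Continues (p ▷ s) w
  continues-step ok ¬down = mk⇔
    (λ { (e , _ ∷ pts , _ ∷ sts) → e , pts , sts })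
    (λ { (e , pts , sts) → e , ok ∷ pts , ¬down ∷ sts })

  ⇔-step : ∀ {p s} → P ≗⇔ Continues p → (OnDiagonal p → IsEndpoint n p) →
    ¬ CrossesDown (p , s) → P ∘ (s ∷_) ≗⇔ Continues (p ▷ s)
  ⇔-step {s = s} P⇔ ok ¬down w = mk⇔
    (Equivalence.to (continues-step ok ¬down) ∘ Equivalence.to (P⇔ (s ∷ w)))
    (Equivalence.from (P⇔ (s ∷ w)) ∘ Equivalence.from (continues-step ok ¬down))

  sum-suc : ∀ p s m → coordinateSum p + suc m ≡ 5 * n → coordinateSum (p ▷ s) + m ≡ 5 * n
  sum-suc (x , y) right m eq = trans (sym (+-suc (x + y) m)) eq
  sum-suc (x , y) up    m eq = trans (cong (_+ m) (+-suc x y)) (trans (sym (+-suc (x + y) m)) eq)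

  corner-sum : coordinateSum (corner n) ≡ 5 * n
  corner-sum = sym (*-distribʳ-+ n 3 2)

  corner-onDiagonal : OnDiagonal (corner n)
  corner-onDiagonal = 3*2n≡2*3n n
    where
    3*2n≡2*3n : ∀ n → 3 * (2 * n) ≡ 2 * (3 * n)
    3*2n≡2*3n = solve-∀

  onDiagonal⇒corner : ∀ p → OnDiagonal p → coordinateSum p ≡ 5 * n → p ≡ corner n
  onDiagonal⇒corner (x , y) diag sum = cong₂ _,_
    (*-cancelˡ-≡ x (3 * n) 5 (begin
      5 * x          ≡⟨ *-distribʳ-+ x 3 2 ⟩
      3 * x + 2 * x  ≡⟨ cong (3 * x +_) diag ⟨
      3 * x + 3 * y  ≡⟨ *-distribˡ-+ 3 x y ⟨
      3 * (x + y)    ≡⟨ cong (3 *_) sum ⟩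
      3 * (5 * n)    ≡⟨ swap 3 5 n ⟩
      5 * (3 * n)    ∎))
    (*-cancelˡ-≡ y (2 * n) 5 (begin
      5 * y          ≡⟨ *-distribʳ-+ y 2 3 ⟩
      2 * y + 3 * y  ≡⟨ cong (2 * y +_) diag ⟩
      2 * y + 2 * x  ≡⟨ +-comm (2 * y) (2 * x) ⟩
      2 * x + 2 * y  ≡⟨ *-distribˡ-+ 2 x y ⟨
      2 * (x + y)    ≡⟨ cong (2 *_) sum ⟩
      2 * (5 * n)    ≡⟨ swap 2 5 n ⟩
      5 * (2 * n)    ∎))
    where
    open ≡-Reasoning
    swap : ∀ a b c → a * (b * c) ≡ b * (a * c)
    swap = solve-∀

  -- Away from the origin a permitted diagonal point is the corner, whose coordinate sum leaves no
  -- further steps.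
  count-onDiagonal : ∀ {p} (P? : Decidable P) → P ≗⇔ Continues p →
    OnDiagonal p → p ≢ origin → ∀ m → coordinateSum p + m ≡ 5 * n → count P? m ≡ δ m 0
  count-onDiagonal {p = p} P? P⇔ diag p≢0 zero sum = cong length (List.filter-accept P?
    (Equivalence.from (P⇔ []) (p≡corner , (λ _ → inj₂ p≡corner) ∷ [] , [])))
    where
    p≡corner : p ≡ corner n
    p≡corner = onDiagonal⇒corner p diag (trans (sym (+-identityʳ _)) sum)
  count-onDiagonal {p = p} P? P⇔ diag p≢0 (suc m) sum = count-none P? (suc m) none
    where
    none : ∀ w → ¬ _
    none w Pw with All-latticePoints-head p w (proj₁ (proj₂ (Equivalence.to (P⇔ w) Pw))) diag
    ... | inj₁ p≡0      = p≢0 p≡0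
    ... | inj₂ p≡corner = m≢1+m+n (coordinateSum p)
      (trans (trans (trans (cong coordinateSum p≡corner) (corner-sum)) (sym sum)) (+-suc _ m))

  count-end : ∀ {p} (P? : Decidable P) → P ≗⇔ Continues p → ¬ OnDiagonal p → count P? 0 ≡ 0
  count-end P? P⇔ ¬diag = cong length (List.filter-reject P? {xs = []}
    λ P[] → ¬diag (subst OnDiagonal (sym (proj₁ (Equivalence.to (P⇔ []) P[]))) corner-onDiagonal))

  -- Splitting by the first step reproduces the recurrence `firstPassages-step`; the height 3y - 2x
  -- is a + 1.
  count-above : ∀ m x y a (P? : Decidable P) → P ≗⇔ Continues (x , y) →
    3 * y ≡ suc a + 2 * x → coordinateSum (x , y) + m ≡ 5 * n → count P? m ≡ firstPassages m a
  count-above zero    x y a P? P⇔ height sum =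
    count-end P? P⇔ λ diag → m≢1+n+m (2 * x) {a} (trans (sym diag) height)
  count-above {P = P} (suc m) x y a P? P⇔ height sum = begin
    count P? (suc m)
      ≡⟨ count-suc P? m ⟩
    count (P? ∘ (right ∷_)) m + count (P? ∘ (up ∷_)) m
      ≡⟨ +-comm (count (P? ∘ (right ∷_)) m) _ ⟩
    count (P? ∘ (up ∷_)) m + count (P? ∘ (right ∷_)) m
      ≡⟨ cong₂ _+_
           (count-above m x (suc y) (3 + a) (P? ∘ (up ∷_)) (⇔-step {s = up} P⇔ ok λ ())
             (trans (*-suc 3 y) (cong (3 +_) height)) (sum-suc (x , y) up m sum))
           (rightwards a height) ⟩
    firstPassages m (3 + a) + afterRight m a
      ≡⟨ firstPassages-step m a ⟨
    firstPassages (suc m) a ∎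
    where
    open ≡-Reasoning
    ok : OnDiagonal (x , y) → IsEndpoint n (x , y)
    ok diag = contradiction (trans (sym diag) height) (m≢1+n+m (2 * x) {a})
    right-height : ∀ b → 3 * y ≡ 2 + b + 2 * x → 3 * y ≡ b + 2 * suc x
    right-height b height = trans height (shift b x)
      where
      shift : ∀ b x → 2 + b + 2 * x ≡ b + 2 * suc x
      shift = solve-∀
    rightwards : ∀ a → 3 * y ≡ suc a + 2 * x → count (P? ∘ (right ∷_)) m ≡ afterRight m a
    -- The step 1 → -1 is the crossing that the valve forbids.
    rightwards 0 height = count-none (P? ∘ (right ∷_)) m λ w Pw →
      All.head (proj₂ (proj₂ (Equivalence.to (P⇔ (right ∷ w)) Pw)))
        (refl , <⇒≤ (≤-reflexive (sym height)) ,
         ≤-reflexive (trans (cong suc height) (sym (*-suc 2 x))))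
    rightwards 1 height = count-onDiagonal (P? ∘ (right ∷_))
      (⇔-step {s = right} P⇔ ok λ (_ , _ , below) → <⇒≢ below (right-height 0 height))
      (right-height 0 height) (λ ()) m (sum-suc (x , y) right m sum)
    rightwards (suc (suc a)) height = count-above m (suc x) y a (P? ∘ (right ∷_))
      (⇔-step {s = right} P⇔ ok λ (_ , _ , below) →
        <⇒≱ below (≤-trans (m≤n+m (2 * suc x) (suc a)) (≤-reflexive (sym (right-height (suc a) height)))))
      (right-height (suc a) height) (sum-suc (x , y) right m sum)

  -- Here the recurrence is `crossings-step`, with height -(a + 1). A right step from below the
  -- diagonal stays below and is no forbidden crossing.
  count-below : ∀ m x y a (P? : Decidable P) → P ≗⇔ Continues (x , y) →
    2 * x ≡ suc a + 3 * y → coordinateSum (x , y) + m ≡ 5 * n → count P? m ≡ crossings m a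
  count-below zero    x y a P? P⇔ depth sum =
    count-end P? P⇔ λ diag → m≢1+n+m (3 * y) {a} (trans diag depth)
  count-below {P = P} (suc m) x y a P? P⇔ depth sum = begin
    count P? (suc m)
      ≡⟨ count-suc P? m ⟩
    count (P? ∘ (right ∷_)) m + count (P? ∘ (up ∷_)) m
      ≡⟨ cong₂ _+_
           (count-below m (suc x) y (2 + a) (P? ∘ (right ∷_))
             (⇔-step {s = right} P⇔ ok λ (_ , above , _) → <⇒≱ below above)
             (trans (*-suc 2 x) (cong (2 +_) depth)) (sum-suc (x , y) right m sum))
           (upwards a depth) ⟩
    crossings m (2 + a) + afterUp m a
      ≡⟨ crossings-step m a ⟨
    crossings (suc m) a ∎
    where
    open ≡-Reasoning
    below : StrictlyBelow (x , y)
    below = ≤-trans (s≤s (m≤n+m (3 * y) a)) (≤-reflexive (sym depth))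
    ok : OnDiagonal (x , y) → IsEndpoint n (x , y)
    ok diag = contradiction diag (<⇒≢ below)
    P⇔up : P ∘ (up ∷_) ≗⇔ Continues (x , suc y)
    P⇔up = ⇔-step {s = up} P⇔ ok λ ()
    sum-up : coordinateSum (x , suc y) + m ≡ 5 * n
    sum-up = sum-suc (x , y) up m sum
    upwards : ∀ a → 2 * x ≡ suc a + 3 * y → count (P? ∘ (up ∷_)) m ≡ afterUp m a
    upwards 0 depth = count-above m x (suc y) 1 (P? ∘ (up ∷_)) P⇔up
      (trans (*-suc 3 y) (cong (2 +_) (sym depth))) sum-up
    upwards 1 depth = count-above m x (suc y) 0 (P? ∘ (up ∷_)) P⇔up
      (trans (*-suc 3 y) (cong (1 +_) (sym depth))) sum-up
    upwards 2 depth = count-onDiagonal (P? ∘ (up ∷_)) P⇔up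
      (trans (*-suc 3 y) (sym depth)) (λ ()) m sum-up
    upwards (suc (suc (suc a))) depth = count-below m x (suc y) a (P? ∘ (up ∷_)) P⇔up
      (trans depth (shift a y)) sum-up
      where
      shift : ∀ a y → 4 + a + 3 * y ≡ suc a + 3 * suc y
      shift = solve-∀

  -- The `drop 1` in `IsValved` exempts exactly the step `s`, and its starting point is an endpoint
  -- of the bridge.
  valvedMinimalBridge⇔continues : ∀ s →
    IsValvedMinimalBridge n ∘ (s ∷_) ≗⇔ Continues (origin ▷ s)
  valvedMinimalBridge⇔continues s w = mk⇔
    (λ { ((e , _ , _ ∷ pts) , sts) → e , pts , sts })
    (λ { (e , pts , sts) → (e , (λ ()) , (λ _ → inj₁ refl) ∷ pts) , sts })

  -- Minimal Duchon paths as valved paths.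

  isEndpoint⇒onDiagonal : ∀ {p} → IsEndpoint n p → OnDiagonal p
  isEndpoint⇒onDiagonal (inj₁ refl) = refl
  isEndpoint⇒onDiagonal (inj₂ refl) = corner-onDiagonal

  AboveOrEndpoint : Pred Point 0ℓ
  AboveOrEndpoint p = IsEndpoint n p ⊎ StrictlyAbove p

  aboveOrEndpoint⇒¬below : ∀ {p} → AboveOrEndpoint p → ¬ StrictlyBelow p
  aboveOrEndpoint⇒¬below (inj₁ end)   below = <⇒≢ below (isEndpoint⇒onDiagonal end)
  aboveOrEndpoint⇒¬below (inj₂ above) below = <-asym above below

  aboveOrEndpoint⇒noCrossing : ∀ p w → All AboveOrEndpoint (latticePointsFrom p w) →
    All (λ e → ¬ CrossesDown e) (locatedStepsFrom p w)
  aboveOrEndpoint⇒noCrossing p []      _         = []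
  aboveOrEndpoint⇒noCrossing p (s ∷ w) (_ ∷ pts) =
    (λ (_ , _ , below) → aboveOrEndpoint⇒¬below (All-latticePoints-head (p ▷ s) w pts) below)
      ∷ aboveOrEndpoint⇒noCrossing (p ▷ s) w pts

  -- From above, only a right step can reach or pass the diagonal. The valve forbids passing it, and
  -- minimality allows a contact only at the corner.
  continues⇒aboveOrEndpoint : ∀ p w → StrictlyAbove p → Continues p w →
    All AboveOrEndpoint (latticePointsFrom p w)
  continues⇒aboveOrEndpoint p       []       above _ = inj₂ above ∷ []
  continues⇒aboveOrEndpoint (x , y) (up ∷ w) above (e , _ ∷ pts , _ ∷ sts) = inj₂ above ∷
    continues⇒aboveOrEndpoint (x , suc y) w (<-trans above (*-monoʳ-< 3 (n<1+n y))) (e , pts , sts)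
  continues⇒aboveOrEndpoint (x , y) (right ∷ w) above (e , _ ∷ pts , ¬down ∷ sts)
    with <-cmp (2 * suc x) (3 * y)
  ... | tri< above′ _ _ = inj₂ above ∷ continues⇒aboveOrEndpoint (suc x , y) w above′ (e , pts , sts)
  ... | tri> _ _ below  = contradiction (refl , <⇒≤ above , below) ¬down
  ... | tri≈ _ diag _   = inj₂ above ∷ atCorner w e (All-latticePoints-head (suc x , y) w pts (sym diag))
    where
    -- Any step after the corner would make the coordinate sum exceed that of the endpoint.
    atCorner : ∀ w → endpointFrom (suc x , y) w ≡ corner n → IsEndpoint n (suc x , y) →
      All AboveOrEndpoint (latticePointsFrom (suc x , y) w)
    atCorner []      _ end          = inj₁ end ∷ []
    atCorner (s ∷ w) e (inj₂ p≡corner) = contradiction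
      (trans (cong coordinateSum (trans p≡corner (sym e)))
        (trans (coordinateSum-endpointFrom (suc x , y) (s ∷ w)) (+-suc (suc x + y) _)))
      (m≢1+m+n (suc x + y))

  minimalDuchon⇔continues : IsMinimalDuchon n ∘ (up ∷_) ≗⇔ Continues (0 , 1)
  minimalDuchon⇔continues w = mk⇔
    (λ { (e , _ ∷ pts) → e
       , All.map (λ { (inj₁ end) _ → end ; (inj₂ above) diag → contradiction (sym diag) (<⇒≢ above) }) pts
       , aboveOrEndpoint⇒noCrossing (0 , 1) w pts })
    (λ c → proj₁ c , inj₁ (inj₁ refl) ∷ continues⇒aboveOrEndpoint (0 , 1) w (s≤s z≤n) c)

  ¬minimalDuchon-right : ∀ w → ¬ IsMinimalDuchon n (right ∷ w)
  ¬minimalDuchon-right w (_ , _ ∷ pts) =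
    aboveOrEndpoint⇒¬below (All-latticePoints-head (1 , 0) w pts) (s≤s z≤n)

  -- A first step right leads to height -2, index `1` in `crossings`; a first step up leads to
  -- height 3, index `2` in `firstPassages`.
  #valvedMinimalBridges-formula : ∀ k → 5 * n ≡ 2 + k →
    #valvedMinimalBridges n ≡ crossings (suc k) 1 + walks k 1 2
  #valvedMinimalBridges-formula k 5n≡2+k = trans (cong (count V?) 5n≡2+k)
    (trans (count-suc V? (suc k)) (cong₂ _+_
      (count-below (suc k) 1 0 1 (V? ∘ (right ∷_)) (valvedMinimalBridge⇔continues right) refl (sym 5n≡2+k))
      (count-above (suc k) 0 1 2 (V? ∘ (up ∷_)) (valvedMinimalBridge⇔continues up) refl (sym 5n≡2+k))))
    where V? = isValvedMinimalBridge? n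

  #minimalDuchonPaths-formula : ∀ k → 5 * n ≡ 2 + k → #minimalDuchonPaths n ≡ walks k 1 2
  #minimalDuchonPaths-formula k 5n≡2+k = trans (cong (count D?) 5n≡2+k)
    (trans (count-suc D? (suc k)) (cong₂ _+_
      (count-none (D? ∘ (right ∷_)) (suc k) ¬minimalDuchon-right)
      (count-above (suc k) 0 1 2 (D? ∘ (up ∷_)) (minimalDuchon⇔continues) refl (sym 5n≡2+k))))
    where D? = isMinimalDuchon? n

-- From natural numbers to rationals.

toℚᵘ-/ : ∀ i d .{{_ : NonZero d}} → ℚ.toℚᵘ (i ℚ./ d) ℚᵘ.≃ i ℚᵘ./ d
toℚᵘ-/ i (suc d) = ℚ.toℚᵘ-fromℚᵘ (i ℚᵘ./ suc d)

+-/1 : ∀ a b → (ℤ.+ a) ℚ./ 1 ℚ.+ (ℤ.+ b) ℚ./ 1 ≡ (ℤ.+ (a + b)) ℚ./ 1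
+-/1 a b = ℚ.toℚᵘ-injective (begin
  ℚ.toℚᵘ ((ℤ.+ a) ℚ./ 1 ℚ.+ (ℤ.+ b) ℚ./ 1)              ≈⟨ ℚ.toℚᵘ-homo-+ ((ℤ.+ a) ℚ./ 1) ((ℤ.+ b) ℚ./ 1) ⟩
  ℚ.toℚᵘ ((ℤ.+ a) ℚ./ 1) ℚᵘ.+ ℚ.toℚᵘ ((ℤ.+ b) ℚ./ 1)    ≈⟨ ℚᵘ.+-cong (toℚᵘ-/ (ℤ.+ a) 1) (toℚᵘ-/ (ℤ.+ b) 1) ⟩
  (ℤ.+ a) ℚᵘ./ 1 ℚᵘ.+ (ℤ.+ b) ℚᵘ./ 1                    ≈⟨ ℚᵘ.*≡* (cong (ℤ._* ℤ.+ 1)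
    (cong₂ ℤ._+_ (ℤ.*-identityʳ (ℤ.+ a)) (ℤ.*-identityʳ (ℤ.+ b)))) ⟩
  (ℤ.+ (a + b)) ℚᵘ./ 1                                  ≈⟨ toℚᵘ-/ (ℤ.+ (a + b)) 1 ⟨
  ℚ.toℚᵘ ((ℤ.+ (a + b)) ℚ./ 1)                          ∎)
  where open ℚᵘ.≃-Reasoning

/-*-/1 : ∀ a m b t .{{_ : NonZero m}} → m * t ≡ a * b →
  (ℤ.+ a) ℚ./ m ℚ.* ((ℤ.+ b) ℚ./ 1) ≡ (ℤ.+ t) ℚ./ 1
/-*-/1 a (suc m) b t mt≡ab = ℚ.toℚᵘ-injective (begin
  ℚ.toℚᵘ ((ℤ.+ a) ℚ./ suc m ℚ.* ((ℤ.+ b) ℚ./ 1))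
    ≈⟨ ℚ.toℚᵘ-homo-* ((ℤ.+ a) ℚ./ suc m) ((ℤ.+ b) ℚ./ 1) ⟩
  ℚ.toℚᵘ ((ℤ.+ a) ℚ./ suc m) ℚᵘ.* ℚ.toℚᵘ ((ℤ.+ b) ℚ./ 1)
    ≈⟨ ℚᵘ.*-cong (toℚᵘ-/ (ℤ.+ a) (suc m)) (toℚᵘ-/ (ℤ.+ b) 1) ⟩
  ((ℤ.+ a) ℚᵘ./ suc m) ℚᵘ.* ((ℤ.+ b) ℚᵘ./ 1)
    ≈⟨ ℚᵘ.*≡* cross ⟩
  (ℤ.+ t) ℚᵘ./ 1
    ≈⟨ toℚᵘ-/ (ℤ.+ t) 1 ⟨
  ℚ.toℚᵘ ((ℤ.+ t) ℚ./ 1) ∎)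
  where
  open ℚᵘ.≃-Reasoning
  cross : (ℤ.+ a ℤ.* ℤ.+ b) ℤ.* ℤ.+ 1 ≡ ℤ.+ t ℤ.* ℤ.+ (suc m * 1)
  cross = trans (ℤ.*-identityʳ _) (trans (sym (ℤ.pos-* a b)) (trans (cong ℤ.+_
    (trans (sym mt≡ab) (trans (*-comm (suc m) t) (cong (t *_) (sym (*-identityʳ (suc m)))))))
    (ℤ.pos-* t (suc m * 1))))

theorem16 : ∀ (n : ℕ) → .{{_ : NonZero n}} →
    (ℤ.+ #valvedMinimalBridges n) ℚ./ 1 ≡
    (ℤ.+ 6) ℚ./ 1 ℚ.* ((ℤ.+ #minimalDuchonPaths n) ℚ./ 1)
    ℚ.- (ℤ.+ 4) ℚ./ (5 * n ∸ 1) ℚ.* ((ℤ.+ ((5 * n ∸ 1) C (2 * n))) ℚ./ 1)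
theorem16 n@(suc n′) = begin
  -- The subtracted fraction is the natural number `T`. Adding and removing it reduces the claim to
  -- `V + T ≡ 6 * D`.
  V/1                    ≡⟨ ℚ.+-identityʳ V/1 ⟨
  V/1 ℚ.+ ℚ.0ℚ           ≡⟨ cong (V/1 ℚ.+_) (ℚ.+-inverseʳ T/1) ⟨
  V/1 ℚ.+ (T/1 ℚ.- T/1)  ≡⟨ ℚ.+-assoc V/1 T/1 (ℚ.- T/1) ⟨
  V/1 ℚ.+ T/1 ℚ.- T/1    ≡⟨ cong (ℚ._- T/1) (+-/1 V T) ⟩
  (ℤ.+ (V + T)) ℚ./ 1 ℚ.- T/1
    ≡⟨ cong₂ ℚ._-_ (/-*-/1 6 1 D (V + T) (trans (*-identityˡ (V + T)) V+T≡6D))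
         (/-*-/1 4 (5 * n ∸ 1) ((5 * n ∸ 1) C (2 * n)) T 5n-1*T≡4C) ⟨
  (ℤ.+ 6) ℚ./ 1 ℚ.* ((ℤ.+ D) ℚ./ 1)
    ℚ.- (ℤ.+ 4) ℚ./ (5 * n ∸ 1) ℚ.* ((ℤ.+ ((5 * n ∸ 1) C (2 * n))) ℚ./ 1) ∎
  where
  open ≡-Reasoning
  k V D g T : ℕ
  -- Thus `suc k` is 5n - 2, the length left after both end steps are removed, and `g` is D + G.
  k = 2 + 5 * n′
  V = #valvedMinimalBridges n
  D = #minimalDuchonPaths n
  g = walks (suc k) 0 1 + walks (suc k) 1 2
  T = 2 * g
  V/1 T/1 : ℚ.ℚ
  V/1 = (ℤ.+ V) ℚ./ 1
  T/1 = (ℤ.+ T) ℚ./ 1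
  5n≡3+k : 5 * n ≡ 3 + k
  5n≡3+k = *-suc 5 n′
  V+T≡6D : V + T ≡ 6 * D
  V+T≡6D = begin
    V + T
      ≡⟨ cong (_+ T) (Bridges.#valvedMinimalBridges-formula n (suc k) 5n≡3+k) ⟩
    crossings (2 + k) 1 + walks (suc k) 1 2 + T
      ≡⟨ rearrange (crossings (2 + k) 1) (walks (suc k) 0 1) (walks (suc k) 1 2) ⟩
    crossings (2 + k) 1 + 2 * walks (suc k) 0 1 + 3 * walks (suc k) 1 2
      ≡⟨ cong (_+ 3 * walks (suc k) 1 2) (crossings-formula k) ⟩
    3 * walks (suc k) 1 2 + 3 * walks (suc k) 1 2
      ≡⟨ *-distribʳ-+ (walks (suc k) 1 2) 3 3 ⟨
    6 * walks (suc k) 1 2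
      ≡⟨ cong (6 *_) (Bridges.#minimalDuchonPaths-formula n (suc k) 5n≡3+k) ⟨
    6 * D ∎
    where
    rearrange : ∀ c v w → c + w + 2 * (v + w) ≡ c + 2 * v + 3 * w
    rearrange = solve-∀
  5n-1*T≡4C : (5 * n ∸ 1) * T ≡ 4 * ((5 * n ∸ 1) C (2 * n))
  5n-1*T≡4C = subst (λ N → N * T ≡ 4 * (N C (2 * n))) (cong (_∸ 1) (sym 5n≡3+k)) (begin
    (2 + k) * (2 * g)              ≡⟨ double (2 + k) g ⟩
    2 * ((2 + k) * g)              ≡⟨ cong (2 *_) (walks-cycle (suc k) n′ (sym 5n≡3+k)) ⟩
    2 * (2 * ((2 + k) C (2 * n)))  ≡⟨ *-assoc 2 2 ((2 + k) C (2 * n)) ⟨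
    4 * ((2 + k) C (2 * n))        ∎)
    where
    double : ∀ x y → x * (2 * y) ≡ 2 * (x * y)
    double = solve-∀
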